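{- There exists a $(k^2,k;4)$-MOHS for each $k\in\{9,21,27\}$, and there exists a $(121,11;9)$-MOHS.
   Context: Let $G$ be an abelian group of odd order $2v+1\ge 7$. A half-set of $G$ is a subset $V\subseteq G\setminus\{0\}$ containing exactly one element of each pair $\{g,-g\}$, $g\ne 0$. A $(v,k)$ Heffter system on $V$ is a partition of $V$ into blocks of size $k$, each summing to $0$ in $G$. Two Heffter systems on the same half-set are orthogonal if every block of one meets every block of the other in at most one element. A $(v,k;r)$-MOHS is a set of $r$ pairwise orthogonal $(v,k)$ Heffter systems on a common half-set of some abelian group of order $2v+1$. -}

module Defs where

open import Level using (0ℓ; suc)
open import Algebra.Bundles using (AbelianGroup)
open import Data.Nat using (ℕ; _+_; _*_; _≤_)
open import Data.Fin using (Fin)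
open import Data.List using (List; foldr; length)
open import Data.List.Relation.Unary.All using (All)
open import Data.List.Relation.Unary.Any using (Any)
open import Data.List.Relation.Unary.AllPairs using (AllPairs)
import Data.List.Membership.Setoid as Membership
import Data.List.Relation.Binary.Disjoint.Setoid as DisjointLists
import Data.List.Relation.Unary.Unique.Setoid as UniqueLists
open import Data.Product using (_×_)
open import Data.Sum using (_⊎_)
open import Function.Bundles using (Inverse; _⇔_)
open import Relation.Binary.Definitions using (_Respects_)
open import Relation.Binary.PropositionalEquality using (_≡_; _≢_; setoid)
open import Relation.Nullary using (¬_)
open import Relation.Unary using (Pred)

HasOrder : AbelianGroup 0ℓ 0ℓ → ℕ → Set
HasOrder G n = Inverse (AbelianGroup.setoid G) (setoid (Fin n))

module _ (G : AbelianGroup 0ℓ 0ℓ) where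

  open AbelianGroup G using (Carrier; _≈_; _≉_)
    renaming (_∙_ to _⊕_; ε to 0#; _⁻¹ to ⊖_; setoid to S)
  open Membership S using (_∈_)
  open DisjointLists S using (Disjoint)
  open UniqueLists S using (Unique)

  record IsHalfSet (V : Pred Carrier 0ℓ) : Set where
    field
      respects   : V Respects _≈_
      nonzero    : ∀ {g} → V g → g ≉ 0#
      exactlyOne : ∀ {g} → g ≉ 0# →
                   (V g × ¬ V (⊖ g)) ⊎ (¬ V g × V (⊖ g))

  -- A finite subset of G is given by a list of its elements, without
  -- repetition up to ≈, so that its length is its cardinality.
  record IsBlock (k : ℕ) (B : List Carrier) : Set where
    field
      unique  : Unique B
      size    : length B ≡ k
      zeroSum : foldr _⊕_ 0# B ≈ 0#

  record HeffterSystem (V : Pred Carrier 0ℓ) (k : ℕ) : Set where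
    field
      blocks   : List (List Carrier)
      isBlock  : All (IsBlock k) blocks
      disjoint : AllPairs Disjoint blocks
      covers   : ∀ g → V g ⇔ Any (g ∈_) blocks

  MeetInAtMostOne : List Carrier → List Carrier → Set
  MeetInAtMostOne A B =
    ∀ {x y} → x ∈ A → x ∈ B → y ∈ A → y ∈ B → x ≈ y

  Orthogonal : ∀ {V k} → HeffterSystem V k → HeffterSystem V k → Set
  Orthogonal P Q =
    All (λ A → All (MeetInAtMostOne A) (HeffterSystem.blocks Q))
        (HeffterSystem.blocks P)

-- Indexing the systems by Fin r still gives a set of r of them: a nonempty
-- system is never orthogonal to itself, since a zero-sum block of nonzero
-- elements that is not empty has at least two elements.
record MOHS (v k r : ℕ) : Set (suc 0ℓ) where
  field
    G          : AbelianGroup 0ℓ 0ℓ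
    order      : HasOrder G (2 * v + 1)
    order≥7    : 7 ≤ 2 * v + 1
    V          : Pred (AbelianGroup.Carrier G) 0ℓ
    isHalfSet  : IsHalfSet G V
    system     : Fin r → HeffterSystem G V k
    orthogonal : ∀ i j → i ≢ j → Orthogonal G (system i) (system j)

{-# OPTIONS --safe #-}
module Submission where

-- Let φ be an endomorphism of order k (multiplication by a k-th root of unity ω of a field) and
-- let x m, m < k, represent the orbits of ± φ on the nonzero elements; the half-set is the union
-- of the k orbits of φ through the x m.  One Heffter system consists of these orbits.  For every
-- slope s such that Σₘ ω^(s m) x m = 0, another one consists of the transversal
-- { φ^(s m) (x m) }ₘ and its images under the powers of φ.  Two elements common to blocks of
-- the systems of slopes s and t lie in orbits m and n with (s − t)(m − n) ≡ 0 modulo k, so the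
-- systems are orthogonal when s − t is a unit.  For k = 9, 21, 27 the slopes 0, 1, 2 are used
-- in a prime field; for k = 11 there are eight slopes in the field of order 3⁵.

open import Defs
open import Data.Nat using (ℕ; _^_)
open import Data.List using (_∷_; [])
open import Data.List.Membership.Propositional using (_∈_)
open import Data.Product using (_×_)

open import Algebra.Bundles using (AbelianGroup)
open import Algebra.Construct.DirectProduct using (abelianGroup)
open import Algebra.Morphism.Structures using (IsMonoidHomomorphism)
open import Algebra.Properties.CommutativeSemigroup using (interchange)
import Algebra.Properties.Group as GroupProperties
open import Data.Fin as Fin using (Fin; toℕ; fromℕ<; remQuot; combine)
open import Data.Fin.Properties as Fin
  using (toℕ<n; toℕ-injective; toℕ-fromℕ<; fromℕ<-cong; all?; pigeonhole)
open import Data.List using (List; foldr; length; lookup; tabulate; map; _++_)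
open import Data.List.Properties using (length-tabulate; length-map; length-++; tabulate-cong)
open import Data.List.Membership.Propositional.Properties using (∈-lookup)
import Data.List.Membership.Setoid as Membership
import Data.List.Membership.Setoid.Properties as Membershipₚ
open import Data.List.Relation.Unary.All as All using ([]; _∷_)
import Data.List.Relation.Unary.All.Properties as Allₚ
open import Data.List.Relation.Unary.AllPairs using (AllPairs; []; _∷_)
import Data.List.Relation.Unary.AllPairs.Properties as AllPairsₚ
open import Data.List.Relation.Unary.Any using (here; there; any?)
import Data.List.Relation.Unary.Any.Properties as Anyₚ
import Data.List.Relation.Unary.Unique.Setoid as UniqueLists
import Data.List.Relation.Unary.Unique.Setoid.Properties as Uniqueₚ
open import Data.Nat using (zero; suc; pred; _+_; _*_; _≤_; _%_; _/_; NonZero; s<s)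
open import Data.Nat.DivMod
  using (m%n<n; m%n%n≡m%n; m<n⇒m%n≡m; m≡m%n+[m/n]*n; [m+kn]%n≡m%n; m*n%n≡0; %-distribˡ-+; %-distribˡ-*)
open import Data.Nat.GeneralisedArithmetic using (fold; fold-+)
open import Data.Nat.Properties as ℕ
  using (+-comm; +-assoc; +-identityʳ; *-comm; *-zeroʳ; *-distribˡ-+; suc-pred; ≤-reflexive; _≤?_)
open import Data.Nat.Tactic.RingSolver using (solve-∀)
open import Data.Product using (∃₂; _,_; proj₁; proj₂; map₂; uncurry)
open import Data.Product.Function.NonDependent.Setoid using (_×-inverse_)
open import Data.Product.Relation.Binary.Pointwise.NonDependent using (Pointwise-≡↔≡; ×-decidable)
open import Data.Sum using (_⊎_; inj₁; inj₂)
open import Data.Vec as Vec using (Vec; []; _∷_)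
import Function.Construct.Composition as Composition
open import Function using (_∘_; Inverse; mk⇔)
open import Function.Properties.Inverse using (Inverse⇒Injection; ↔-sym)
open import Function.Bundles using (Injection)
open import Level using (0ℓ)
open import Relation.Binary using (Setoid; Decidable)
import Relation.Binary.Construct.On as On
open import Relation.Binary.PropositionalEquality as ≡
  using (_≡_; _≢_; refl; cong; cong₂; sym; trans; setoid; module ≡-Reasoning)
open import Relation.Nullary using (¬_; yes; no; contradiction; ¬?; _×-dec_; _→-dec_)
open import Relation.Nullary.Decidable using (Dec; True; toWitness; map′)
open import Relation.Unary using (Pred)

-- Arithmetic modulo `k` and the cyclic group.

module _ (k : ℕ) .{{_ : NonZero k}} where

  %-+-cong : ∀ {a b c d} → a % k ≡ b % k → c % k ≡ d % k → (a + c) % k ≡ (b + d) % k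
  %-+-cong {a} {b} {c} {d} a≡b c≡d = begin
    (a + c) % k          ≡⟨ %-distribˡ-+ a c k ⟩
    (a % k + c % k) % k  ≡⟨ cong₂ (λ m n → (m + n) % k) a≡b c≡d ⟩
    (b % k + d % k) % k  ≡⟨ %-distribˡ-+ b d k ⟨
    (b + d) % k          ∎
    where open ≡-Reasoning

  %-*-congˡ : ∀ m {a b} → a % k ≡ b % k → (m * a) % k ≡ (m * b) % k
  %-*-congˡ m {a} {b} a≡b = begin
    (m * a) % k            ≡⟨ %-distribˡ-* m a k ⟩
    (m % k * (a % k)) % k  ≡⟨ cong (λ z → (m % k * z) % k) a≡b ⟩
    (m % k * (b % k)) % k  ≡⟨ %-distribˡ-* m b k ⟨
    (m * b) % k            ∎
    where open ≡-Reasoning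

  -- Multiplication by `pred k` acts as negation modulo `k`, which avoids truncated subtraction here
  -- and in everything below.
  pred-n*m+m≡m*n : ∀ m → pred k * m + m ≡ m * k
  pred-n*m+m≡m*n m = begin
    pred k * m + m    ≡⟨ +-comm (pred k * m) m ⟩
    suc (pred k) * m  ≡⟨ cong (_* m) (suc-pred k) ⟩
    k * m             ≡⟨ *-comm k m ⟩
    m * k             ∎
    where open ≡-Reasoning

  pred-n*m+m%n≡0 : ∀ m → (pred k * m + m) % k ≡ 0
  pred-n*m+m%n≡0 m = trans (cong (_% k) (pred-n*m+m≡m*n m)) (m*n%n≡0 m k)

  pred-n*m+[m+o]%n≡o%n : ∀ m o → (pred k * m + (m + o)) % k ≡ o % k
  pred-n*m+[m+o]%n≡o%n m o = begin
    (pred k * m + (m + o)) % k  ≡⟨ cong (_% k) (+-assoc (pred k * m) m o) ⟨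
    (pred k * m + m + o) % k    ≡⟨ cong (λ z → (z + o) % k) (pred-n*m+m≡m*n m) ⟩
    (m * k + o) % k             ≡⟨ cong (_% k) (+-comm (m * k) o) ⟩
    (o + m * k) % k             ≡⟨ [m+kn]%n≡m%n o m k ⟩
    o % k                       ∎
    where open ≡-Reasoning

  %-+-cancelˡ : ∀ m {a b} → (m + a) % k ≡ (m + b) % k → a % k ≡ b % k
  %-+-cancelˡ m {a} {b} eq = begin
    a % k                       ≡⟨ pred-n*m+[m+o]%n≡o%n m a ⟨
    (pred k * m + (m + a)) % k  ≡⟨ %-+-cong {pred k * m} refl eq ⟩
    (pred k * m + (m + b)) % k  ≡⟨ pred-n*m+[m+o]%n≡o%n m b ⟩
    b % k                       ∎
    where open ≡-Reasoning

  -- Elements are unreduced naturals compared by their residues, so that the group operation is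
  -- `_+_` itself.
  ℤmod : AbelianGroup 0ℓ 0ℓ
  ℤmod = record
    { Carrier = ℕ
    ; _≈_     = λ a b → a % k ≡ b % k
    ; _∙_     = _+_
    ; ε       = 0
    ; _⁻¹     = pred k *_
    ; isAbelianGroup = record
      { isGroup = record
        { isMonoid = record
          { isSemigroup = record
            { isMagma = record
              { isEquivalence = On.isEquivalence (_% k) ≡.isEquivalence
              ; ∙-cong = λ {a} {b} → %-+-cong {a} {b}
              }
            ; assoc = λ a b c → cong (_% k) (+-assoc a b c)
            }
          ; identity = (λ a → refl) , (λ a → cong (_% k) (+-identityʳ a))
          }
        ; inverse = inverseˡ , λ a → trans (cong (_% k) (+-comm a (pred k * a))) (inverseˡ a)
        ; ⁻¹-cong = λ {a} {b} → %-*-congˡ (pred k) {a} {b}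
        }
      ; comm = λ a b → cong (_% k) (+-comm a b)
      }
    }
    where
    inverseˡ : ∀ a → (pred k * a + a) % k ≡ 0 % k
    inverseˡ a = trans (pred-n*m+m%n≡0 a) (sym (m*n%n≡0 0 k))

  ℤmod-order : HasOrder ℤmod k
  ℤmod-order = record
    { to        = λ a → fromℕ< (m%n<n a k)
    ; from      = toℕ
    ; to-cong   = λ {a} {b} eq → fromℕ<-cong _ _ eq (m%n<n a k) (m%n<n b k)
    ; from-cong = cong (λ i → toℕ i % k)
    ; inverse   = (λ {i} {a} → to-from {i} {a}) , λ {a} {i} → from-to {a} {i}
    }
    where
    to-from : ∀ {i : Fin k} {a} → a % k ≡ toℕ i % k → fromℕ< (m%n<n a k) ≡ i
    to-from {i} {a} eq = toℕ-injective (begin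
      toℕ (fromℕ< (m%n<n a k))  ≡⟨ toℕ-fromℕ< (m%n<n a k) ⟩
      a % k                     ≡⟨ eq ⟩
      toℕ i % k                 ≡⟨ m<n⇒m%n≡m (toℕ<n i) ⟩
      toℕ i                     ∎)
      where open ≡-Reasoning

    from-to : ∀ {a} {i : Fin k} → i ≡ fromℕ< (m%n<n a k) → toℕ i % k ≡ a % k
    from-to {a} refl = trans (cong (_% k) (toℕ-fromℕ< (m%n<n a k))) (m%n%n≡m%n a k)

-- Direct powers of a group.

module _ (G : AbelianGroup 0ℓ 0ℓ) where

  -- power n is the direct product of n + 1 copies of G.
  power : ℕ → AbelianGroup 0ℓ 0ℓ
  power zero    = G
  power (suc n) = abelianGroup G (power n)

  -- The iterated product is m to the power n + 1, written to follow the recursion of `power`; it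
  -- evaluates to 243 for m = 3 and n = 4.
  power-order : ∀ {m} → HasOrder G m → ∀ n → HasOrder (power n) (fold m (m *_) n)
  power-order       G-order zero    = G-order
  power-order {m}   G-order (suc n) =
    Composition.inverse (Composition.inverse (G-order ×-inverse power-order G-order n) Pointwise-≡↔≡)
      (↔-sym (Fin.*↔× {m}))

  power-decidable : Decidable (AbelianGroup._≈_ G) → ∀ n → Decidable (AbelianGroup._≈_ (power n))
  power-decidable _≟_ zero    = _≟_
  power-decidable _≟_ (suc n) = ×-decidable _≟_ (power-decidable _≟_ n)

-- Counting in a finite setoid.

AllPairs-lookup : ∀ {a ℓ} {A : Set a} {R : A → A → Set ℓ} {xs} → AllPairs R xs →
                  ∀ {i j} → i Fin.< j → R (lookup xs i) (lookup xs j)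
AllPairs-lookup {xs = x ∷ xs} (Rx ∷ _)  {Fin.zero}  {Fin.suc j} _         = All.lookup Rx (∈-lookup j)
AllPairs-lookup {xs = x ∷ xs} (_ ∷ Rxs) {Fin.suc i} {Fin.suc j} (s<s i<j) = AllPairs-lookup Rxs i<j

module _ {S : Setoid 0ℓ 0ℓ} {n} (S↔Fin : Inverse S (setoid (Fin n))) where

  open Setoid S using (Carrier; _≈_)
  open Membership S using () renaming (_∈_ to _∈ₛ_)
  open UniqueLists S using (Unique)
  open Injection (Inverse⇒Injection S↔Fin) using (to; injective) renaming (cong to to-cong)

  ≈-dec : Decidable _≈_
  ≈-dec x y = map′ injective to-cong (to x Fin.≟ to y)

  -- Pigeonhole: a missing `g` would make `g ∷ xs` a list of n + 1 distinct elements.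
  unique-exhaustive : ∀ {xs} → Unique xs → length xs ≡ n → ∀ g → g ∈ₛ xs
  unique-exhaustive {xs} xs! ∣xs∣≡n g with any? (≈-dec g) xs
  ... | yes g∈xs = g∈xs
  ... | no g∉xs with i , j , i<j , eq ← pigeonhole (≤-reflexive (cong suc (sym ∣xs∣≡n)))
                                                   (to ∘ lookup (g ∷ xs)) =
    contradiction (injective eq) (AllPairs-lookup (Allₚ.¬Any⇒All¬ xs g∉xs ∷ xs!) i<j)

-- Iterates of an endomorphism and sums.

module _ {G : AbelianGroup 0ℓ 0ℓ} where

  open AbelianGroup G using (rawMonoid; _∙_; ε) renaming (Carrier to C)

  fold-isMonoidHomomorphism : ∀ {φ : C → C} → IsMonoidHomomorphism rawMonoid rawMonoid φ →
    ∀ n → IsMonoidHomomorphism rawMonoid rawMonoid (λ z → fold z φ n)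
  fold-isMonoidHomomorphism {φ} φ-hom n = record
    { isMagmaHomomorphism = record
      { isRelHomomorphism = record { cong = fold-cong n }
      ; homo = fold-homo n
      }
    ; ε-homo = fold-ε n
    }
    where
    open AbelianGroup G using (_≈_) renaming (refl to ≈-refl; trans to ≈-trans)
    open IsMonoidHomomorphism φ-hom

    fold-cong : ∀ n {x y} → x ≈ y → fold x φ n ≈ fold y φ n
    fold-cong zero    x≈y = x≈y
    fold-cong (suc n) x≈y = ⟦⟧-cong (fold-cong n x≈y)

    fold-homo : ∀ n x y → fold (x ∙ y) φ n ≈ fold x φ n ∙ fold y φ n
    fold-homo zero    x y = ≈-refl
    fold-homo (suc n) x y = ≈-trans (⟦⟧-cong (fold-homo n x y)) (homo (fold x φ n) (fold y φ n))

    fold-ε : ∀ n → fold ε φ n ≈ ε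
    fold-ε zero    = ≈-refl
    fold-ε (suc n) = ≈-trans (⟦⟧-cong (fold-ε n)) ε-homo

  module _ {φ : C → C} (φ-hom : IsMonoidHomomorphism rawMonoid rawMonoid φ) where

    open AbelianGroup G using (_≈_; ∙-cong) renaming (refl to ≈-refl; sym to ≈-sym; trans to ≈-trans)
    open IsMonoidHomomorphism φ-hom

    sum-homo : ∀ {n} (f : Fin n → C) →
               foldr _∙_ ε (tabulate (φ ∘ f)) ≈ φ (foldr _∙_ ε (tabulate f))
    sum-homo {zero}  f = ≈-sym ε-homo
    sum-homo {suc n} f =
      ≈-trans (∙-cong ≈-refl (sum-homo (f ∘ Fin.suc))) (≈-sym (homo _ _))

-- Heffter systems from orbits and transversals.

module Orbits
  (G : AbelianGroup 0ℓ 0ℓ)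
  (_≟_ : Decidable (AbelianGroup._≈_ G))
  {φ : AbelianGroup.Carrier G → AbelianGroup.Carrier G}
  (φ-hom : IsMonoidHomomorphism (AbelianGroup.rawMonoid G) (AbelianGroup.rawMonoid G) φ)
  (k : ℕ) .{{_ : NonZero k}}
  (x : Fin k → AbelianGroup.Carrier G)
  {r : ℕ} (c : Fin r → ℕ)
  where

  open AbelianGroup G using (_≈_; _≉_; _∙_; ε; _⁻¹; ∙-cong; identityˡ; inverseʳ; ⁻¹-cong)
    renaming (Carrier to C; setoid to S;
              refl to ≈-refl; sym to ≈-sym; trans to ≈-trans; reflexive to ≈-reflexive)
  open Membership S using () renaming (_∈_ to _∈ₛ_)
  open GroupProperties (AbelianGroup.group G) using (⁻¹-injective; ⁻¹-involutive)

  point : Fin k → ℕ → C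
  point i a = fold (x i) φ a

  Σ[_] : (Fin k → C) → C
  Σ[ f ] = foldr _∙_ ε (tabulate f)

  -- In `Separated` the second point is always a representative, which leaves of the order of k³
  -- cases to check instead of k⁴. The congruence in `SlopesDiffer` is (c s - c t)(m - n) ≡ 0 with
  -- the negative terms moved across.
  Periodic Separated OrbitSums TransversalSums SlopesDiffer : Set
  Periodic        = ∀ i → point i k ≈ x i
  Separated       = ∀ i j (a : Fin k) → point i (toℕ a) ∙ x j ≉ ε ×
                      (point i (toℕ a) ≈ x j → i ≡ j × toℕ a ≡ 0)
  OrbitSums       = ∀ i → Σ[ (λ a → point i (toℕ a)) ] ≈ ε
  TransversalSums = ∀ s → Σ[ (λ m → point m (c s * toℕ m)) ] ≈ ε
  SlopesDiffer    = ∀ s t → s ≢ t → ∀ (m n : Fin k) →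
                      (c s * toℕ m + c t * toℕ n) % k ≡ (c t * toℕ m + c s * toℕ n) % k → m ≡ n

  Conditions : Set
  Conditions = Periodic × Separated × OrbitSums × TransversalSums × SlopesDiffer

  -- All quantifiers range over finite sets, so a concrete instance is verified by evaluating this
  -- decision.
  conditions? : Dec Conditions
  conditions? =
    all? (λ i → point i k ≟ x i) ×-dec
    all? (λ i → all? λ j → all? λ a → ¬? ((point i (toℕ a) ∙ x j) ≟ ε) ×-dec
      ((point i (toℕ a) ≟ x j) →-dec ((i Fin.≟ j) ×-dec (toℕ a ℕ.≟ 0)))) ×-dec
    all? (λ i → Σ[ (λ a → point i (toℕ a)) ] ≟ ε) ×-dec
    all? (λ s → Σ[ (λ m → point m (c s * toℕ m)) ] ≟ ε) ×-dec
    all? (λ s → all? λ t → ¬? (s Fin.≟ t) →-dec all? λ m → all? λ n →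
      ((c s * toℕ m + c t * toℕ n) % k ℕ.≟ (c t * toℕ m + c s * toℕ n) % k) →-dec (m Fin.≟ n))

  module _ (conditions : Conditions) where

    periodic : Periodic
    periodic = proj₁ conditions

    separated : Separated
    separated = proj₁ (proj₂ conditions)

    module Power n = IsMonoidHomomorphism (fold-isMonoidHomomorphism {G} φ-hom n)

    point-+*k : ∀ i a n → point i (a + n * k) ≈ point i a
    point-+*k i a zero    = ≈-reflexive (cong (point i) (+-identityʳ a))
    -- The extra `k` iterations are moved innermost, next to `x i`, where periodicity applies.
    point-+*k i a (suc n) = ≈-trans (≈-reflexive (trans (cong (point i) (lemma a k (n * k)))
        (fold-+ (x i) φ (a + n * k))))
      (≈-trans (Power.⟦⟧-cong (a + n * k) (periodic i)) (point-+*k i a n))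
      where
      lemma : ∀ a b c → a + (b + c) ≡ a + c + b
      lemma = solve-∀

    point-% : ∀ i a → point i a ≈ point i (a % k)
    point-% i a = ≈-trans (≈-reflexive (cong (point i) (m≡m%n+[m/n]*n a k)))
                          (point-+*k i (a % k) (a / k))

    point-cong : ∀ {i j a b} → i ≡ j → a % k ≡ b % k → point i a ≈ point j b
    point-cong {i} {a = a} {b} refl eq =
      ≈-trans (point-% i a) (≈-trans (≈-reflexive (cong (point i) eq)) (≈-sym (point-% i b)))

    -- Applying φ to the power −b, so that the second point becomes the representative x j.
    module Rewind (i : Fin k) (a : ℕ) (j : Fin k) (b : ℕ) where

      a′ : ℕ
      a′ = (pred k * b + a) % k

      a″ : Fin k
      a″ = fromℕ< (m%n<n (pred k * b + a) k)

      a″≡a′ : toℕ a″ ≡ a′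
      a″≡a′ = toℕ-fromℕ< (m%n<n (pred k * b + a) k)

      left : fold (point i a) φ (pred k * b) ≈ point i (toℕ a″)
      left = ≈-trans (≈-reflexive (sym (fold-+ (x i) φ (pred k * b))))
        (≈-trans (point-% i (pred k * b + a)) (≈-reflexive (cong (point i) (sym a″≡a′))))

      right : fold (point j b) φ (pred k * b) ≈ x j
      right = ≈-trans (≈-reflexive (sym (fold-+ (x j) φ (pred k * b))))
        (≈-trans (point-% j (pred k * b + b)) (≈-reflexive (cong (point j) (pred-n*m+m%n≡0 k b))))

    -- After rewinding, `Separated` forces the residue of a - b to be 0.
    point-injective : ∀ i a j b → point i a ≈ point j b → i ≡ j × a % k ≡ b % k
    point-injective i a j b eq = map₂ a≡b (proj₂ (separated i j a″) moved)
      where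
      open Rewind i a j b
      moved : point i (toℕ a″) ≈ x j
      moved = ≈-trans (≈-sym left) (≈-trans (Power.⟦⟧-cong (pred k * b) eq) right)
      a≡b : toℕ a″ ≡ 0 → a % k ≡ b % k
      a≡b a″≡0 = %-+-cancelˡ k (pred k * b)
        (trans (trans (sym a″≡a′) a″≡0) (sym (pred-n*m+m%n≡0 k b)))

    point∙point≉ε : ∀ i a j b → point i a ∙ point j b ≉ ε
    point∙point≉ε i a j b eq = proj₁ (separated i j a″)
      (≈-trans (∙-cong (≈-sym left) (≈-sym right))
        (≈-trans (≈-sym (Power.homo (pred k * b) _ _))
          (≈-trans (Power.⟦⟧-cong (pred k * b) eq) (Power.ε-homo (pred k * b)))))
      where open Rewind i a j b

    -- A zero point would have zero sum with itself.
    point≉ε : ∀ i a → point i a ≉ ε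
    point≉ε i a eq = point∙point≉ε i a i a (≈-trans (∙-cong eq eq) (identityˡ ε))

    toℕ%-injective : ∀ {m n : Fin k} → toℕ m % k ≡ toℕ n % k → m ≡ n
    toℕ%-injective {m} {n} eq = toℕ-injective
      (trans (sym (m<n⇒m%n≡m (toℕ<n m))) (trans eq (m<n⇒m%n≡m (toℕ<n n))))

    V : Pred C 0ℓ
    V g = ∃₂ λ i a → g ≈ point i a

    ¬V-both : ∀ {g} → V g → ¬ V (g ⁻¹)
    ¬V-both {g} (i , a , g≈p) (j , b , g⁻¹≈q) = point∙point≉ε i a j b
      (≈-trans (∙-cong (≈-sym g≈p) (≈-sym g⁻¹≈q)) (inverseʳ g))

    module _ (order : HasOrder G (2 * k ^ 2 + 1)) where

      pointAt : Fin (k * k) → C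
      pointAt m = point (proj₁ (remQuot {k} k m)) (toℕ (proj₂ (remQuot {k} k m)))

      pointAt-injective : ∀ {m n} → pointAt m ≈ pointAt n → m ≡ n
      pointAt-injective {m} {n} eq
        with i≡j , a≡b ← point-injective _ (toℕ (proj₂ (remQuot {k} k m)))
                                         _ (toℕ (proj₂ (remQuot {k} k n))) eq = begin
        m                                    ≡⟨ Fin.combine-remQuot {k} k m ⟨
        uncurry combine (remQuot {k} k m)    ≡⟨ cong₂ combine i≡j (toℕ%-injective a≡b) ⟩
        uncurry combine (remQuot {k} k n)    ≡⟨ Fin.combine-remQuot {k} k n ⟩
        n                                    ∎
        where open ≡-Reasoning

      -- Zero, the k² points and their negatives are 2k² + 1 distinct elements, as many as the group
      -- has. Hence every nonzero element is a point or the negative of one, which gives the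
      -- half-set property.
      points elements : List C
      points   = tabulate pointAt
      elements = ε ∷ points ++ map _⁻¹ points

      ∈points⇒V : ∀ {g} → g ∈ₛ points → V g
      ∈points⇒V g∈ =
        let m , g≈ = Membershipₚ.∈-tabulate⁻ S g∈
        in proj₁ (remQuot {k} k m) , toℕ (proj₂ (remQuot {k} k m)) , g≈

      ∈inverses⇒V : ∀ {g} → g ∈ₛ map _⁻¹ points → V (g ⁻¹)
      ∈inverses⇒V g∈ =
        let h , h∈ , g≈h⁻¹ = Membershipₚ.∈-map⁻ S S g∈; i , a , h≈ = ∈points⇒V h∈
        in i , a , ≈-trans (⁻¹-cong g≈h⁻¹) (≈-trans (⁻¹-involutive h) h≈)

      elements-unique : UniqueLists.Unique S elements
      elements-unique = Allₚ.¬Any⇒All¬ _ ε∉ ∷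
        Uniqueₚ.++⁺ S points! (Uniqueₚ.map⁺ S S ⁻¹-injective points!)
          λ (v∈ , v∈′) → ¬V-both (∈points⇒V v∈) (∈inverses⇒V v∈′)
        where
        points! = Uniqueₚ.tabulate⁺ S pointAt-injective
        V⇒≉ε : ∀ {g} → V g → g ≉ ε
        V⇒≉ε (i , a , g≈) g≈ε = point≉ε i a (≈-trans (≈-sym g≈) g≈ε)
        ε∉ : ¬ ε ∈ₛ (points ++ map _⁻¹ points)
        ε∉ ε∈ with Membershipₚ.∈-++⁻ S points ε∈
        ... | inj₁ ε∈p = V⇒≉ε (∈points⇒V ε∈p) ≈-refl
        ... | inj₂ ε∈n = V⇒≉ε (∈inverses⇒V ε∈n) (≈-trans (≈-sym (identityˡ _)) (inverseʳ ε))

      length-elements : length elements ≡ 2 * k ^ 2 + 1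
      length-elements = trans (cong suc (trans (length-++ points)
          (cong₂ _+_ ∣points∣ (trans (length-map _⁻¹ points) ∣points∣)))) (lemma k)
        where
        ∣points∣ = length-tabulate pointAt
        lemma : ∀ k → suc (k * k + k * k) ≡ 2 * (k * (k * 1)) + 1
        lemma = solve-∀

      isHalfSet : IsHalfSet G V
      isHalfSet = record
        { respects   = λ g≈h (i , a , g≈) → i , a , ≈-trans (≈-sym g≈h) g≈
        ; nonzero    = λ (i , a , g≈) g≈ε → point≉ε i a (≈-trans (≈-sym g≈) g≈ε)
        ; exactlyOne = λ {g} g≉ε → classify g≉ε (unique-exhaustive order elements-unique length-elements g)
        }
        where
        classify : ∀ {g} → g ≉ ε → g ∈ₛ elements → (V g × ¬ V (g ⁻¹)) ⊎ (¬ V g × V (g ⁻¹))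
        classify g≉ε (here g≈ε) = contradiction g≈ε g≉ε
        classify g≉ε (there g∈) with Membershipₚ.∈-++⁻ S points g∈
        ... | inj₁ g∈p = let Vg = ∈points⇒V g∈p in inj₁ (Vg , ¬V-both Vg)
        ... | inj₂ g∈n = let V-g = ∈inverses⇒V g∈n in inj₂ ((λ Vg → ¬V-both Vg V-g) , V-g)

    -- The value is the number of an orbit; `ℓ` labels a block and `m` a position in it. System zero
    -- consists of the orbits, and system `suc s` of the images of the transversal of slope `c s`,
    -- whose position `m` lies in orbit `m`.
    index : Fin (suc r) → Fin k → Fin k → Fin k
    index Fin.zero    ℓ m = ℓ
    index (Fin.suc _) ℓ m = m

    exponent : Fin (suc r) → Fin k → Fin k → ℕ
    exponent Fin.zero    ℓ m = toℕ m
    exponent (Fin.suc s) ℓ m = toℕ ℓ + c s * toℕ m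

    entry : Fin (suc r) → Fin k → Fin k → C
    entry s ℓ m = point (index s ℓ m) (exponent s ℓ m)

    toℕ-fromℕ<-% : ∀ a → toℕ (fromℕ< (m%n<n a k)) % k ≡ a % k
    toℕ-fromℕ<-% a = trans (cong (_% k) (toℕ-fromℕ< (m%n<n a k))) (m%n%n≡m%n a k)

    entry-≈⇒ : ∀ s t {ℓ m ℓ′ m′ g} → g ≈ entry s ℓ m → g ≈ entry t ℓ′ m′ →
               index s ℓ m ≡ index t ℓ′ m′ × exponent s ℓ m % k ≡ exponent t ℓ′ m′ % k
    entry-≈⇒ s t {ℓ} {m} {ℓ′} {m′} g≈ g≈′ =
      point-injective (index s ℓ m) (exponent s ℓ m) (index t ℓ′ m′) (exponent t ℓ′ m′)
        (≈-trans (≈-sym g≈) g≈′)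

    -- This serves both distinctness within a block and disjointness of blocks. In a transversal
    -- system the orbit determines `m`, and cancelling `c s * toℕ m` from the exponent then
    -- determines `ℓ`.
    entry-injective : ∀ s {ℓ m ℓ′ m′ g} → g ≈ entry s ℓ m → g ≈ entry s ℓ′ m′ → ℓ ≡ ℓ′ × m ≡ m′
    entry-injective Fin.zero {ℓ} {m} {ℓ′} {m′} g≈ g≈′ =
      map₂ toℕ%-injective (entry-≈⇒ Fin.zero Fin.zero {ℓ} {m} {ℓ′} {m′} g≈ g≈′)
    entry-injective (Fin.suc s) {ℓ} {m} {ℓ′} {m′} g≈ g≈′
      with refl , eq′ ← entry-≈⇒ (Fin.suc s) (Fin.suc s) {ℓ} {m} {ℓ′} {m′} g≈ g≈′ =
      toℕ%-injective (%-+-cancelˡ k (c s * toℕ m) (trans (cong (_% k) (+-comm (c s * toℕ m) (toℕ ℓ)))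
        (trans eq′ (cong (_% k) (+-comm (toℕ ℓ′) (c s * toℕ m)))))) , refl

    entry-surjective : ∀ s i a → ∃₂ λ ℓ m → point i a ≈ entry s ℓ m
    entry-surjective Fin.zero    i a =
      i , fromℕ< (m%n<n a k) , point-cong {i} refl (sym (toℕ-fromℕ<-% a))
    -- The label must solve ℓ + d ≡ a modulo `k`; `h` represents a - d.
    entry-surjective (Fin.suc s) i a = fromℕ< (m%n<n h k) , i , point-cong {i} refl (sym (begin
      (toℕ (fromℕ< (m%n<n h k)) + d) % k  ≡⟨ %-+-cong k (toℕ-fromℕ<-% h) refl ⟩
      (pred k * d + a + d) % k            ≡⟨ cong (_% k) (lemma (pred k * d) a d) ⟩
      (pred k * d + (d + a)) % k          ≡⟨ pred-n*m+[m+o]%n≡o%n k d a ⟩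
      a % k                               ∎))
      where
      open ≡-Reasoning
      d = c s * toℕ i
      h = pred k * d + a
      lemma : ∀ a b c → a + b + c ≡ a + (c + b)
      lemma = solve-∀

    -- Block `ℓ` of a transversal system is the image of the base transversal under the additive map
    -- φ^ℓ, so its sum is the image of zero.
    entry-sum : ∀ s ℓ → Σ[ entry s ℓ ] ≈ ε
    entry-sum Fin.zero    ℓ = proj₁ (proj₂ (proj₂ conditions)) ℓ
    entry-sum (Fin.suc s) ℓ = begin
      Σ[ entry (Fin.suc s) ℓ ]
        ≡⟨ cong (foldr _∙_ ε) (tabulate-cong λ m → fold-+ (x m) φ (toℕ ℓ)) ⟩
      Σ[ (λ m → fold (point m (c s * toℕ m)) φ (toℕ ℓ)) ]
        ≈⟨ sum-homo {G} (fold-isMonoidHomomorphism {G} φ-hom (toℕ ℓ)) (λ m → point m (c s * toℕ m)) ⟩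
      fold Σ[ (λ m → point m (c s * toℕ m)) ] φ (toℕ ℓ)
        ≈⟨ Power.⟦⟧-cong (toℕ ℓ) (proj₁ (proj₂ (proj₂ (proj₂ conditions))) s) ⟩
      fold ε φ (toℕ ℓ)
        ≈⟨ Power.ε-homo (toℕ ℓ) ⟩
      ε ∎
      where open import Relation.Binary.Reasoning.Setoid S

    block : Fin (suc r) → Fin k → List C
    block s ℓ = tabulate (entry s ℓ)

    system : Fin (suc r) → HeffterSystem G V k
    system s = record
      { blocks   = tabulate (block s)
      ; isBlock  = Allₚ.tabulate⁺ λ ℓ → record
        { unique  = Uniqueₚ.tabulate⁺ S λ {m} {n} eq →
                      proj₂ (entry-injective s {ℓ} {m} {ℓ} {n} ≈-refl eq)
        ; size    = length-tabulate (entry s ℓ)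
        ; zeroSum = entry-sum s ℓ
        }
      ; disjoint = AllPairsₚ.tabulate⁺ λ {ℓ} {ℓ′} ℓ≢ℓ′ (v∈ , v∈′) →
          let m , v≈ = Membershipₚ.∈-tabulate⁻ S v∈; m′ , v≈′ = Membershipₚ.∈-tabulate⁻ S v∈′
          in ℓ≢ℓ′ (proj₁ (entry-injective s {ℓ} {m} {ℓ′} {m′} v≈ v≈′))
      ; covers   = λ g → mk⇔
          (λ (i , a , g≈) → let ℓ , m , eq = entry-surjective s i a in
            Anyₚ.tabulate⁺ ℓ (Anyₚ.tabulate⁺ m (≈-trans g≈ eq)))
          (λ g∈ → let ℓ , g∈ℓ = Anyₚ.tabulate⁻ g∈; m , g≈ = Membershipₚ.∈-tabulate⁻ S g∈ℓ in
            index s ℓ m , exponent s ℓ m , g≈)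
      }

    Common : Fin (suc r) → Fin (suc r) → Fin k → Fin k → C → Set
    Common s t ℓ ℓ′ g = ∃₂ λ m m′ → g ≈ entry s ℓ m × g ≈ entry t ℓ′ m′

    -- An orbit can meet a transversal only at the position bearing the number of that orbit. Two
    -- transversals share elements only at equal positions, and unequal slopes allow at most one
    -- such position.
    common-unique : ∀ s t → s ≢ t → ∀ ℓ ℓ′ {g h} → Common s t ℓ ℓ′ g → Common s t ℓ ℓ′ h → g ≈ h
    common-unique Fin.zero Fin.zero s≢t ℓ ℓ′ _ _ = contradiction refl s≢t
    common-unique Fin.zero (Fin.suc t) _ ℓ ℓ′ (m , m′ , g≈ , g≈′) (n , n′ , h≈ , h≈′)
      with refl , _ ← entry-≈⇒ Fin.zero (Fin.suc t) {ℓ} {m} {ℓ′} {m′} g≈ g≈′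
         | refl , _ ← entry-≈⇒ Fin.zero (Fin.suc t) {ℓ} {n} {ℓ′} {n′} h≈ h≈′ =
      ≈-trans g≈′ (≈-sym h≈′)
    common-unique (Fin.suc s) Fin.zero _ ℓ ℓ′ (m , m′ , g≈ , g≈′) (n , n′ , h≈ , h≈′)
      with refl , _ ← entry-≈⇒ (Fin.suc s) Fin.zero {ℓ} {m} {ℓ′} {m′} g≈ g≈′
         | refl , _ ← entry-≈⇒ (Fin.suc s) Fin.zero {ℓ} {n} {ℓ′} {n′} h≈ h≈′ =
      ≈-trans g≈ (≈-sym h≈)
    common-unique (Fin.suc s) (Fin.suc t) s≢t ℓ ℓ′ (m , m′ , g≈ , g≈′) (n , n′ , h≈ , h≈′)
      with refl , eqₘ ← entry-≈⇒ (Fin.suc s) (Fin.suc t) {ℓ} {m} {ℓ′} {m′} g≈ g≈′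
         | refl , eqₙ ← entry-≈⇒ (Fin.suc s) (Fin.suc t) {ℓ} {n} {ℓ′} {n′} h≈ h≈′ =
      ≈-trans g≈ (≈-trans (≈-reflexive (cong (entry (Fin.suc s) ℓ) m≡n)) (≈-sym h≈))
      where
      lemma : ∀ l l′ p q → l + p + (l′ + q) ≡ l + l′ + (p + q)
      lemma = solve-∀
      lemma′ : ∀ l l′ p q → l′ + p + (l + q) ≡ l + l′ + (p + q)
      lemma′ = solve-∀
      m≡n : m ≡ n
      -- Adding ℓ + c s m ≡ ℓ′ + c t m to ℓ′ + c t n ≡ ℓ + c s n and cancelling ℓ + ℓ′ leaves the
      -- congruence of `SlopesDiffer`.
      m≡n = proj₂ (proj₂ (proj₂ (proj₂ conditions))) s t (s≢t ∘ cong Fin.suc) m n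
        (%-+-cancelˡ k (toℕ ℓ + toℕ ℓ′)
          (trans (cong (_% k) (sym (lemma (toℕ ℓ) (toℕ ℓ′) (c s * toℕ m) (c t * toℕ n))))
          (trans (%-+-cong k eqₘ (sym eqₙ))
            (cong (_% k) (lemma′ (toℕ ℓ) (toℕ ℓ′) (c t * toℕ m) (c s * toℕ n))))))

    orthogonal : ∀ s t → s ≢ t → Orthogonal G (system s) (system t)
    orthogonal s t s≢t = Allₚ.tabulate⁺ λ ℓ → Allₚ.tabulate⁺ λ ℓ′ g∈ g∈′ h∈ h∈′ →
      let m , g≈ = Membershipₚ.∈-tabulate⁻ S g∈; m′ , g≈′ = Membershipₚ.∈-tabulate⁻ S g∈′
          n , h≈ = Membershipₚ.∈-tabulate⁻ S h∈; n′ , h≈′ = Membershipₚ.∈-tabulate⁻ S h∈′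
      in common-unique s t s≢t ℓ ℓ′ (m , m′ , g≈ , g≈′) (n , n′ , h≈ , h≈′)

  mohs : HasOrder G (2 * k ^ 2 + 1) → 7 ≤ 2 * k ^ 2 + 1 → True conditions? → MOHS (k ^ 2) k (suc r)
  mohs order order≥7 conditions-hold = record
    { G          = G
    ; order      = order
    ; order≥7    = order≥7
    ; V          = V conditions
    ; isHalfSet  = isHalfSet conditions order
    ; system     = system conditions
    ; orthogonal = orthogonal conditions
    }
    where conditions = toWitness conditions-hold

-- Instances in prime fields.

module _ (q : ℕ) .{{_ : NonZero q}} where

  -- Reducing inside the map keeps iterates small when the conditions are evaluated.
  *-isMonoidHomomorphism : ∀ w → let M = AbelianGroup.rawMonoid (ℤmod q) in
                           IsMonoidHomomorphism M M (λ a → w * a % q)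
  *-isMonoidHomomorphism w = record
    { isMagmaHomomorphism = record
      { isRelHomomorphism = record { cong = λ {a} {b} eq → cong (_% q) (%-*-congˡ q w {a} {b} eq) }
      ; homo = λ a b → begin
          w * (a + b) % q % q            ≡⟨ m%n%n≡m%n (w * (a + b)) q ⟩
          w * (a + b) % q                ≡⟨ cong (_% q) (*-distribˡ-+ w a b) ⟩
          (w * a + w * b) % q            ≡⟨ %-distribˡ-+ (w * a) (w * b) q ⟩
          (w * a % q + w * b % q) % q    ∎
      }
    ; ε-homo = trans (cong (λ z → z % q % q) (*-zeroʳ w)) (m%n%n≡m%n 0 q)
    }
    where open ≡-Reasoning

  -- Here `toℕ` on `Fin 3` lists the slopes 0, 1, 2, whose differences ±1 and ±2 are units modulo an
  -- odd `k`. In the instances q = 2k² + 1 is prime and `w` has order `k` modulo `q`.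
  module PrimeField (w k : ℕ) .{{_ : NonZero k}} (xs : Vec ℕ k) =
    Orbits (ℤmod q) (λ a b → a % q ℕ.≟ b % q) (*-isMonoidHomomorphism w) k (Vec.lookup xs) {3} toℕ

-- The representatives were found by choosing all but the last three, one in each orbit, and
-- solving the linear equations Σₘ ω^(s m) x m = 0, s = 0, 1, 2, for the last three.
mohs-9 : MOHS (9 ^ 2) 9 4
mohs-9 = PrimeField.mohs 163 38 9 (18 ∷ 10 ∷ 9 ∷ 5 ∷ 15 ∷ 2 ∷ 49 ∷ 17 ∷ 38 ∷ [])
  (ℤmod-order 163) (toWitness {a? = 7 ≤? 163} _) _

mohs-21 : MOHS (21 ^ 2) 21 4
mohs-21 = PrimeField.mohs 883 86 21
  (26 ∷ 6 ∷ 1 ∷ 9 ∷ 18 ∷ 7 ∷ 12 ∷ 91 ∷ 11 ∷ 19 ∷ 3 ∷ 2 ∷ 44 ∷ 14 ∷ 52 ∷ 38 ∷ 29 ∷ 4 ∷ 806 ∷ 673 ∷ 784 ∷ [])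
  (ℤmod-order 883) (toWitness {a? = 7 ≤? 883} _) _

mohs-27 : MOHS (27 ^ 2) 27 4
mohs-27 = PrimeField.mohs 1459 53 27
  (9 ∷ 26 ∷ 34 ∷ 68 ∷ 87 ∷ 8 ∷ 58 ∷ 18 ∷ 16 ∷ 36 ∷ 4 ∷ 23 ∷ 51 ∷ 13 ∷ 3 ∷ 39 ∷ 1 ∷ 11 ∷ 12 ∷ 22 ∷ 17 ∷ 6 ∷ 38 ∷ 2
    ∷ 1390 ∷ 441 ∷ 485 ∷ [])
  (ℤmod-order 1459) (toWitness {a? = 7 ≤? 1459} _) _

-- The instance in the field of order 3⁵.

module TernaryField where

  ℤ₃ : AbelianGroup 0ℓ 0ℓ
  ℤ₃ = ℤmod 3

  -- (a , b , c , d , e) stands for a + b z + c z² + d z³ + e z⁴ in 𝔽₃[z]/(z⁵ − z − 1).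
  F : AbelianGroup 0ℓ 0ℓ
  F = power ℤ₃ 4

  open AbelianGroup F using (Carrier; _≈_; rawMonoid)

  F-order : HasOrder F 243
  F-order = power-order ℤ₃ (ℤmod-order 3) 4

  _≟_ : Decidable _≈_
  _≟_ = power-decidable ℤ₃ (λ a b → a % 3 ℕ.≟ b % 3) 4

  -- Since z⁵ = z + 1, the overflowing term e z⁵ returns as e + e z.
  timesZ : Carrier → Carrier
  timesZ (a , b , c , d , e) = e , a + e , b , c , d

  timesZ-isMonoidHomomorphism : IsMonoidHomomorphism rawMonoid rawMonoid timesZ
  timesZ-isMonoidHomomorphism = record
    { isMagmaHomomorphism = record
      { isRelHomomorphism = record
        { cong = λ {(a , _ , _ , _ , e)} {(a′ , _ , _ , _ , e′)} (p , q , r , s , t) →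
            t , %-+-cong 3 {a} {a′} {e} {e′} p t , q , r , s }
      ; homo = λ (a , _ , _ , _ , e) (a′ , _ , _ , _ , e′) →
          refl , cong (_% 3) (interchange ℕ.+-commutativeSemigroup a a′ e e′) , refl , refl , refl
      }
    ; ε-homo = refl , refl , refl , refl , refl
    }

  -- z has order 121, so ω = z¹¹ has order 11.  The representatives are x m = 1 − ωᵐ + ω⁸ᵐ, and
  -- Σₘ ωˢᵐ x m vanishes for all s other than 0, −1 and −8 modulo 11.
  module System = Orbits F _≟_ (fold-isMonoidHomomorphism {F} timesZ-isMonoidHomomorphism 11) 11
    (Vec.lookup
      ( (1 , 0 , 0 , 0 , 0) ∷ (2 , 0 , 0 , 2 , 0) ∷ (1 , 0 , 0 , 0 , 1) ∷ (1 , 2 , 0 , 0 , 2)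
      ∷ (2 , 2 , 0 , 0 , 0) ∷ (1 , 2 , 1 , 1 , 2) ∷ (1 , 0 , 1 , 2 , 1) ∷ (0 , 0 , 2 , 2 , 0)
      ∷ (2 , 2 , 1 , 2 , 2) ∷ (1 , 0 , 2 , 0 , 2) ∷ (2 , 1 , 2 , 0 , 2) ∷ []))
    (Vec.lookup (1 ∷ 2 ∷ 4 ∷ 5 ∷ 6 ∷ 7 ∷ 8 ∷ 9 ∷ []))

-- A sum Σₘ ω^(j m) vanishes unless 11 divides j, which leaves the eight slopes other than 0, 10 and
-- 3. As 11 is prime, their differences are units; the orbits supply the ninth system.
mohs-11 : MOHS (11 ^ 2) 11 9
mohs-11 = TernaryField.System.mohs TernaryField.F-order (toWitness {a? = 7 ≤? 243} _) _

theorem1p15 : (∀ (k : ℕ) → k ∈ 9 ∷ 21 ∷ 27 ∷ [] → MOHS (k ^ 2) k 4) × MOHS 121 11 9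
theorem1p15 = square , mohs-11
  where
  square : ∀ (k : ℕ) → k ∈ 9 ∷ 21 ∷ 27 ∷ [] → MOHS (k ^ 2) k 4
  square _ (here refl)                 = mohs-9
  square _ (there (here refl))         = mohs-21
  square _ (there (there (here refl))) = mohs-27
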